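{- Every digraph $D$ with $\delta^+(D)\ge 2$ contains a subdivision of $\overleftrightarrow{K}_3-e$.
   Context: Digraphs are finite, loopless, without parallel arcs, but may contain digons. $\delta^+(D)$ is the minimum out-degree of $D$. $\overleftrightarrow{K}_3$ is the biorientation of the triangle $K_3$, i.e. the digraph on 3 vertices containing both arcs $(u,v)$ and $(v,u)$ for every pair of distinct vertices; $\overleftrightarrow{K}_3-e$ is the digraph obtained from it by deleting a single arc (all choices are isomorphic). A subdivision of a digraph $F$ is obtained by replacing every arc $(x,y)$ of $F$ by a directed path from $x$ to $y$, with paths for different arcs internally vertex-disjoint; "$D$ contains a subdivision of $F$" means some subdigraph of $D$ is such a subdivision. -}

module Defs where

open import Data.Nat using (ℕ; _≥_)
open import Data.Fin using (Fin)
open import Data.Bool using (Bool; true; false; if_then_else_; T)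
open import Data.List using (List; []; _∷_; _++_; allFin; map)
open import Data.Nat.ListAction using (sum)
open import Data.List.Membership.Propositional using (_∈_; _∉_)
open import Data.List.Relation.Unary.AllPairs using (AllPairs)
open import Data.List.Relation.Unary.Linked using (Linked)
open import Data.List.Relation.Unary.Unique.Propositional using (Unique)
open import Data.Product using (Σ; _×_; ∃-syntax)
open import Relation.Binary.PropositionalEquality using (_≡_)
open import Relation.Nullary using (¬_)

-- A digraph on vertex set Fin n is given by its arc relation (decidable, as Bool).
-- Digons are allowed (A u v and A v u both true); parallel arcs cannot occur.
Digraph : ℕ → Set
Digraph n = Fin n → Fin n → Bool

Arc : ∀ {n} → Digraph n → Fin n → Fin n → Set
Arc A u v = T (A u v)

Loopless : ∀ {n} → Digraph n → Set
Loopless {n} A = (v : Fin n) → ¬ Arc A v v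

outdeg : ∀ {n} → Digraph n → Fin n → ℕ
outdeg {n} A v = sum (map (λ u → if A v u then 1 else 0) (allFin n))

MinOutDeg≥ : ∀ {n} → Digraph n → ℕ → Set
MinOutDeg≥ {n} A k = (v : Fin n) → outdeg A v ≥ k

record DPath {n} (A : Digraph n) (x y : Fin n) : Set where
  constructor dpath
  field
    internal : List (Fin n)
    walk     : Linked (Arc A) (x ∷ internal ++ y ∷ [])
    simple   : Unique (x ∷ internal ++ y ∷ [])
open DPath public

Disjoint : ∀ {n} → List (Fin n) → List (Fin n) → Set
Disjoint xs ys = ∀ {v} → v ∈ xs → v ∉ ys

-- K3 biorientation minus one arc: vertices a b c, arcs
--   a→b, b→a, b→c, c→b, a→c   (the arc c→a is deleted).
-- A subdivision in A: distinct branch vertices x y z (images of a b c) and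
-- five directed paths for the five arcs, internally vertex-disjoint, whose
-- internal vertices avoid the branch vertices.
record SubdivK3e {n} (A : Digraph n) : Set where
  field
    x y z : Fin n
    branch-distinct : Unique (x ∷ y ∷ z ∷ [])
    pxy : DPath A x y
    pyx : DPath A y x
    pyz : DPath A y z
    pzy : DPath A z y
    pxz : DPath A x z
    internals-avoid-branch :
      (v : Fin n) → v ∈ (x ∷ y ∷ z ∷ []) →
      v ∉ (internal pxy ++ internal pyx ++ internal pyz ++ internal pzy ++ internal pxz)
    internals-disjoint :
      AllPairs Disjoint
        (internal pxy ∷ internal pyx ∷ internal pyz ∷ internal pzy ∷ internal pxz ∷ [])

{-# OPTIONS --safe #-}

-- The induction is on the number of vertices, and one exceptional vertex s is
-- allowed to have a single out-neighbour t; the subdivision found has y ≠ s.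
-- Starting from the list s, t, keep putting in front of it a vertex with two
-- out-neighbours in the list.
--
-- If t itself has two out-neighbours in the list, let two paths start there and
-- always move the front one of their two heads down the list, to a vertex
-- other than t and the other head.  When this is impossible, that head x has
-- arcs to t and to the other head z, and z still reaches t further down the
-- list: this is the subdivision, with y = t.
--
-- Otherwise, once the list is maximal, contract it to t.  No other vertex has
-- two arcs into the list, so only t may drop to out-degree one and it takes over
-- the role of s.  The contraction is undone one vertex c at a time, where c has
-- an arc to t: an arc into t may have to be rerouted through c, and if both
-- paths into z = t have to, then c replaces t as z.  As y ≠ t, nothing else
-- can happen.
module Submission where

open import Defs
open import Data.Bool using (Bool; true; false; if_then_else_; T; T?)
open import Data.Fin using (Fin; zero)
open import Data.Fin.Patterns using (0F; 1F; 2F; 3F; 4F)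
open import Data.Fin.Properties using (_≟_)
open import Data.List using (List; []; _∷_; _++_; length; filter; allFin; map)
open import Data.List.Membership.DecPropositional using (_∈?_)
open import Data.List.Membership.Propositional using (_∈_; _∉_; find; lose)
open import Data.List.Membership.Propositional.Properties using (∈-filter⁺; ∈-filter⁻; ∈-allFin)
open import Data.List.Properties using (filter-notAll)
open import Data.List.Relation.Unary.All as All using (All; []; _∷_)
open import Data.List.Relation.Unary.All.Properties using (¬Any⇒All¬; ++⁺)
open import Data.List.Relation.Unary.AllPairs using ([]; _∷_)
open import Data.List.Relation.Unary.Any using (Any; here; there; any?)
open import Data.List.Relation.Unary.Linked as Linked using (Linked; [-]; _∷_)
open import Data.List.Relation.Unary.Unique.Propositional using (Unique)
import Data.List.Relation.Unary.Unique.Propositional.Properties as Unique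
open import Data.Maybe as Maybe using (Maybe; just; nothing)
open import Data.Maybe.Properties using (just-injective)
open import Data.Nat using (ℕ; zero; suc; _≤_; _<_; s≤s; s≤s⁻¹)
open import Data.Nat.ListAction using (sum)
open import Data.Nat.Properties using (≤-refl; ≤-trans; <⇒≤; <-≤-trans)
open import Data.Product using (∃; ∃₂; ∃-syntax; _×_; _,_; proj₁; proj₂)
open import Data.Sum using (_⊎_; inj₁; inj₂; [_,_]′)
open import Function using (_∘_)
open import Relation.Binary.PropositionalEquality using (_≡_; _≢_; refl; sym; trans; cong; subst; ≢-sym)
open import Relation.Nullary using (¬_; Dec; yes; no; does; contradiction)
open import Relation.Nullary.Decidable using (map′; ¬?; _×-dec_; _⊎-dec_)
open import Relation.Unary using (Decidable)

private variable
  n : ℕ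

-- Walks with constrained interiors, and loop erasure

Graph : ℕ → Set₁
Graph n = Fin n → Fin n → Set

infixr 5 _⟨_⟩_

-- `P` constrains interior vertices only, so uncoloured branch vertices can be the ends. Repetitions
-- are allowed, so rerouting a walk creates no obligation to keep it simple.
data Walk (G : Graph n) (P : Fin n → Set) : Fin n → Fin n → Set where
  arc : ∀ {u w} → G u w → Walk G P u w
  _⟨_⟩_ : ∀ {u v w} → G u v → P v → Walk G P v w → Walk G P u w

module _ {G : Graph n} where

  mapWalk : ∀ {P Q : Fin n → Set} {u w} → (∀ {v} → P v → Q v) → Walk G P u w → Walk G Q u w
  mapWalk f (arc g) = arc g
  mapWalk f (g ⟨ p ⟩ r) = g ⟨ f p ⟩ mapWalk f r

  snoc : ∀ {P : Fin n → Set} {u v w} → Walk G P u v → P v → G v w → Walk G P u w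
  snoc (arc g) p h = g ⟨ p ⟩ arc h
  snoc (g ⟨ q ⟩ r) p h = g ⟨ q ⟩ snoc r p h

  firstArc : ∀ {P : Fin n → Set} {u w} → Walk G P u w → ∃ (G u)
  firstArc (arc g) = _ , g
  firstArc (g ⟨ _ ⟩ _) = _ , g

  suffixFrom : ∀ {P : Fin n → Set} {u y} l → u ∈ l → Linked G (l ++ y ∷ []) → Unique l → All P l →
               ∃[ l′ ] Linked G (u ∷ l′ ++ y ∷ []) × Unique (u ∷ l′) × All P (u ∷ l′)
  suffixFrom (_ ∷ l) (here refl) lk un ps = l , lk , un , ps
  suffixFrom (_ ∷ l) (there u∈l) lk (_ ∷ un) (_ ∷ ps) = suffixFrom l u∈l (Linked.tail lk) un ps

  -- If the next vertex already occurs in the loop-free interior, the walk is resumed from that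
  -- occurrence.
  eraseLoops : ∀ {P : Fin n → Set} {u w} → Walk G P u w →
               ∃[ l ] Linked G (u ∷ l ++ w ∷ []) × Unique l × All P l
  eraseLoops (arc g) = [] , g ∷ [-] , [] , []
  eraseLoops (_⟨_⟩_ {v = v} g p r) with eraseLoops r
  ... | l , lk , un , ps with _∈?_ _≟_ v l
  ...   | no v∉l = v ∷ l , g ∷ lk , ¬Any⇒All¬ l v∉l ∷ un , p ∷ ps
  ...   | yes v∈l with suffixFrom l v∈l (Linked.tail lk) un ps
  ...     | l′ , lk′ , un′ , ps′ = v ∷ l′ , g ∷ lk′ , un′ , ps′

-- Subdivisions as colourings

Colouring : ℕ → Set
Colouring n = Fin n → Maybe (Fin 5)

pattern xy = 0F
pattern yx = 1F
pattern yz = 2F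
pattern zy = 3F
pattern xz = 4F

Coloured : Colouring n → Fin 5 → Fin n → Set
Coloured col i v = col v ≡ just i

-- Giving the internal vertices of the i-th path colour i makes the five paths
-- disjoint by construction; loops are erased only at the very end.
record Subdivision (G : Graph n) (y : Fin n) : Set where
  field
    {x z} : Fin n
    x≢y : x ≢ y
    x≢z : x ≢ z
    y≢z : y ≢ z
    col : Colouring n
    col-x : col x ≡ nothing
    col-y : col y ≡ nothing
    col-z : col z ≡ nothing
    wxy : Walk G (Coloured col xy) x y
    wyx : Walk G (Coloured col yx) y x
    wyz : Walk G (Coloured col yz) y z
    wzy : Walk G (Coloured col zy) z y
    wxz : Walk G (Coloured col xz) x z

mapSubdivision : ∀ {H K : Graph n} {y} → (∀ {u w} → H u w → K u w) → Subdivision H y → Subdivision K y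
mapSubdivision {n} {H} {K} f S = record
  { Subdivision S ; wxy = go wxy ; wyx = go wyx ; wyz = go wyz ; wzy = go wzy ; wxz = go wxz }
  where
  open Subdivision S
  go : ∀ {P : Fin n → Set} {u w} → Walk H P u w → Walk K P u w
  go (arc g) = arc (f g)
  go (g ⟨ p ⟩ r) = f g ⟨ p ⟩ go r

just≢nothing : ∀ {m : Maybe (Fin 5)} {i} → m ≡ nothing → m ≢ just i
just≢nothing refl ()

-- A coloured interior cannot meet the uncoloured ends, so distinct ends suffice for a simple path.
toDPath : ∀ {A : Digraph n} {col : Colouring n} {i u w} → u ≢ w → col u ≡ nothing → col w ≡ nothing →
          Walk (Arc A) (Coloured col i) u w → ∃[ p ] All (Coloured col i) (internal {A = A} {u} {w} p)
toDPath {col = col} {i} {u} {w} u≢w cu cw walk with eraseLoops walk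
... | l , lk , un , ps = dpath l lk (++⁺ u∉l (u≢w ∷ []) ∷ Unique.++⁺ un ([] ∷ []) w∉l) , ps
  where
  u∉l : All (u ≢_) l
  u∉l = All.map (λ { p refl → just≢nothing cu p }) ps
  w∉l : ∀ {v} → ¬ (v ∈ l × v ∈ w ∷ [])
  w∉l (v∈l , here refl) = just≢nothing cw (All.lookup ps v∈l)

toSubdivK3e : ∀ {A : Digraph n} {y} → Subdivision (Arc A) y → SubdivK3e A
toSubdivK3e {n} {A} {y} S = record
  { x = x ; y = y ; z = z
  ; branch-distinct = (x≢y ∷ x≢z ∷ []) ∷ (y≢z ∷ []) ∷ [] ∷ []
  ; pxy = proj₁ pxy ; pyx = proj₁ pyx ; pyz = proj₁ pyz ; pzy = proj₁ pzy ; pxz = proj₁ pxz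
  ; internals-avoid-branch = λ v v∈b v∈l → just≢nothing (branch v∈b) (proj₂ (coloured v∈l))
  ; internals-disjoint =
      (sep (λ ()) pxy pyx ∷ sep (λ ()) pxy pyz ∷ sep (λ ()) pxy pzy ∷ sep (λ ()) pxy pxz ∷ [])
      ∷ (sep (λ ()) pyx pyz ∷ sep (λ ()) pyx pzy ∷ sep (λ ()) pyx pxz ∷ [])
      ∷ (sep (λ ()) pyz pzy ∷ sep (λ ()) pyz pxz ∷ [])
      ∷ (sep (λ ()) pzy pxz ∷ []) ∷ [] ∷ []
  }
  where
  open Subdivision S
  Path : Fin 5 → Fin n → Fin n → Set
  Path i u w = ∃[ p ] All (Coloured col i) (internal {A = A} {u} {w} p)
  pxy : Path xy x y
  pxy = toDPath x≢y col-x col-y wxy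
  pyx : Path yx y x
  pyx = toDPath (≢-sym x≢y) col-y col-x wyx
  pyz : Path yz y z
  pyz = toDPath y≢z col-y col-z wyz
  pzy : Path zy z y
  pzy = toDPath (≢-sym y≢z) col-z col-y wzy
  pxz : Path xz x z
  pxz = toDPath x≢z col-x col-z wxz
  branch : ∀ {v} → v ∈ x ∷ y ∷ z ∷ [] → col v ≡ nothing
  branch (here refl) = col-x
  branch (there (here refl)) = col-y
  branch (there (there (here refl))) = col-z
  sep : ∀ {i j u w u′ w′} → i ≢ j → (p : Path i u w) (q : Path j u′ w′) →
        Disjoint (internal (proj₁ p)) (internal (proj₁ q))
  sep i≢j (_ , ps) (_ , qs) v∈p v∈q =
    i≢j (just-injective (trans (sym (All.lookup ps v∈p)) (All.lookup qs v∈q)))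
  someColour : ∀ {i u w} (p : Path i u w) → All (λ v → ∃[ j ] col v ≡ just j) (internal (proj₁ p))
  someColour (_ , ps) = All.map (_ ,_) ps
  coloured : ∀ {v} → v ∈ internal (proj₁ pxy) ++ internal (proj₁ pyx) ++ internal (proj₁ pyz)
                          ++ internal (proj₁ pzy) ++ internal (proj₁ pxz) → ∃[ j ] col v ≡ just j
  coloured = All.lookup (++⁺ (someColour pxy) (++⁺ (someColour pyx) (++⁺ (someColour pyz)
               (++⁺ (someColour pzy) (someColour pxz)))))

opaque

  -- The new value may be `nothing`: this is how a vertex becomes a branch vertex.
  recolour : {P : Fin n → Set} → Decidable P → Maybe (Fin 5) → Colouring n → Colouring n
  recolour P? m col v = if does (P? v) then m else col v

  recolour-in : ∀ {P : Fin n → Set} (P? : Decidable P) {m col v} → P v → recolour P? m col v ≡ m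
  recolour-in P? {v = v} p with P? v
  ... | yes _ = refl
  ... | no ¬p = contradiction p ¬p

  recolour-out : ∀ {P : Fin n → Set} (P? : Decidable P) {m col v} → ¬ P v → recolour P? m col v ≡ col v
  recolour-out P? {v = v} ¬p with P? v
  ... | yes p = contradiction p ¬p
  ... | no _ = refl

-- Undoing the contraction of one vertex

record Contracts (G : Graph n) (c t : Fin n) (H : Graph n) : Set where
  field
    exit : G c t
    c≢t : c ≢ t
    source : ∀ {u w} → H u w → u ≢ c
    target : ∀ {u w} → H u w → w ≢ c
    arcs : ∀ {u w} → H u w → G u w ⊎ (w ≡ t × G u c)

module _ {G H : Graph n} {c t : Fin n} (con : Contracts G c t H) where
  open Contracts con

  -- An arc into `t` without a counterpart in `G` becomes a detour through `c`. Several detours only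
  -- repeat `c`, which a walk permits.
  liftVia : ∀ {P Q : Fin n → Set} {u w} → (∀ {v} → v ≢ c → P v → Q v) → Q c →
            Walk H P u w → Walk G Q u w
  liftVia f qc (arc h) with arcs h
  ... | inj₁ g = arc g
  ... | inj₂ (refl , g) = g ⟨ qc ⟩ arc exit
  liftVia f qc (h ⟨ p ⟩ r) with arcs h
  ... | inj₁ g = g ⟨ f (target h) p ⟩ liftVia f qc r
  ... | inj₂ (refl , g) = g ⟨ qc ⟩ exit ⟨ f (target h) p ⟩ liftVia f qc r

  -- Such a walk never enters `t`, and arcs of `H` with another head are arcs of `G`.
  liftAvoiding : ∀ {P Q : Fin n → Set} {u w} → (∀ {v} → v ≢ c → P v → Q v) → ¬ P t → w ≢ t →
                 Walk H P u w → Walk G Q u w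
  liftAvoiding f ¬pt w≢t (arc h) with arcs h
  ... | inj₁ g = arc g
  ... | inj₂ (w≡t , _) = contradiction w≡t w≢t
  liftAvoiding f ¬pt w≢t (h ⟨ p ⟩ r) with arcs h
  ... | inj₁ g = g ⟨ f (target h) p ⟩ liftAvoiding f ¬pt w≢t r
  ... | inj₂ (refl , _) = contradiction p ¬pt

  -- Only the last arc enters `t`. If it must be rerouted, the walk stops at `c`, leaving open
  -- whether to go on to `t`.
  liftEnding : ∀ {P Q : Fin n → Set} {u} → (∀ {v} → v ≢ c → P v → Q v) → ¬ P t →
               Walk H P u t → Walk G Q u t ⊎ Walk G Q u c
  liftEnding f ¬pt (arc h) with arcs h
  ... | inj₁ g = inj₁ (arc g)
  ... | inj₂ (_ , g) = inj₂ (arc g)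
  liftEnding f ¬pt (h ⟨ p ⟩ r) with arcs h
  ... | inj₂ (refl , _) = contradiction p ¬pt
  ... | inj₁ g = [ (λ r′ → inj₁ (g ⟨ f (target h) p ⟩ r′)) , (λ r′ → inj₂ (g ⟨ f (target h) p ⟩ r′)) ]′
                   (liftEnding f ¬pt r)

  module _ {y : Fin n} (S : Subdivision H y) where
    open Subdivision S

    private
      x≢c : x ≢ c
      x≢c = source (proj₂ (firstArc wxy))
      y≢c : y ≢ c
      y≢c = source (proj₂ (firstArc wyx))
      z≢c : z ≢ c
      z≢c = source (proj₂ (firstArc wzy))

    colourInterior : Fin 5 → Colouring n
    colourInterior i = recolour (_≟ c) (just i) col

    module _ (i : Fin 5) where
      private
        col′ = colourInterior i

        keep : ∀ {m v} → v ≢ c → col v ≡ m → col′ v ≡ m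
        keep v≢c = trans (recolour-out (_≟ c) v≢c)

      liftColoured : ∀ {j u w} → j ≡ i ⊎ (¬ Coloured col j t × w ≢ t) →
                     Walk H (Coloured col j) u w → Walk G (Coloured col′ j) u w
      liftColoured (inj₁ refl) = liftVia keep (recolour-in (_≟ c) refl)
      liftColoured (inj₂ (ct , w≢t)) = liftAvoiding keep ct w≢t

      assemble : Walk G (Coloured col′ xy) x y → Walk G (Coloured col′ yx) y x →
                 Walk G (Coloured col′ yz) y z → Walk G (Coloured col′ zy) z y →
                 Walk G (Coloured col′ xz) x z → Subdivision G y
      assemble pxy pyx pyz pzy pxz = record
        { x≢y = x≢y ; x≢z = x≢z ; y≢z = y≢z ; col = col′
        ; col-x = keep x≢c col-x ; col-y = keep y≢c col-y ; col-z = keep z≢c col-z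
        ; wxy = pxy ; wyx = pyx ; wyz = pyz ; wzy = pzy ; wxz = pxz }

    -- When `t` is not a branch vertex, only the walk of its colour can enter it, and `c` takes that
    -- colour.
    liftInternal : x ≢ t → y ≢ t → z ≢ t → Subdivision G y
    liftInternal x≢t y≢t z≢t = assemble i
      (liftColoured i (side y≢t) wxy) (liftColoured i (side x≢t) wyx) (liftColoured i (side z≢t) wyz)
      (liftColoured i (side y≢t) wzy) (liftColoured i (side z≢t) wxz)
      where
      i : Fin 5
      -- If `t` is uncoloured, no walk enters it and any colour does for `c`.
      i = Maybe.fromMaybe xy (col t)
      side : ∀ {j w} → w ≢ t → j ≡ i ⊎ (¬ Coloured col j t × w ≢ t)
      side {j} w≢t with col t
      ... | nothing = inj₂ ((λ ()) , w≢t)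
      ... | just k with j ≟ k
      ...   | yes j≡k = inj₁ j≡k
      ...   | no j≢k = inj₂ ((j≢k ∘ sym ∘ just-injective) , w≢t)

    private
      off : ∀ {v j k w} → col v ≡ nothing → w ≢ v → j ≡ k ⊎ (¬ Coloured col j v × w ≢ v)
      off cv w≢v = inj₂ (just≢nothing cv , w≢v)

    -- Only the walk from `y` ends at `x`, so `c` can take the colour `yx`.
    lift-x : x ≡ t → Subdivision G y
    lift-x refl = assemble yx
      (liftColoured yx (off col-x (≢-sym x≢y)) wxy) (liftColoured yx (inj₁ refl) wyx)
      (liftColoured yx (off col-x (≢-sym x≢z)) wyz) (liftColoured yx (off col-x (≢-sym x≢y)) wzy)
      (liftColoured yx (off col-x (≢-sym x≢z)) wxz)

    -- Two walks end at `z`. If one of them does without `c`, the other may use it.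
    lift-z : z ≡ t → Subdivision G y
    -- The colour of `c` depends on the outcome, so for now the interiors only record that they
    -- avoid `c`.
    lift-z refl with liftEnding (λ v≢c p → p , v≢c) (just≢nothing col-z) wyz
                   | liftEnding (λ v≢c p → p , v≢c) (just≢nothing col-z) wxz
    ... | inj₁ r | _ = assemble xz
      (liftColoured xz (off col-z y≢z) wxy) (liftColoured xz (off col-z x≢z) wyx)
      (mapWalk (λ (p , v≢c) → trans (recolour-out (_≟ c) v≢c) p) r)
      (liftColoured xz (off col-z y≢z) wzy) (liftColoured xz (inj₁ refl) wxz)
    ... | inj₂ _ | inj₁ r = assemble yz
      (liftColoured yz (off col-z y≢z) wxy) (liftColoured yz (off col-z x≢z) wyx)
      (liftColoured yz (inj₁ refl) wyz) (liftColoured yz (off col-z y≢z) wzy)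
      (mapWalk (λ (p , v≢c) → trans (recolour-out (_≟ c) v≢c) p) r)
    -- Both walks end at `c`, the new `z`. The old one becomes interior to the walk to `y`, which
    -- now starts with the arc from `c` to `t`.
    ... | inj₂ r | inj₂ r′ = record
      { x≢y = x≢y ; x≢z = x≢c ; y≢z = y≢c ; col = col″
      ; col-x = uncoloured x≢c x≢z col-x
      ; col-y = uncoloured y≢c y≢z col-y
      ; col-z = recolour-in (_≟ c) refl
      ; wxy = liftAvoiding keep (just≢nothing col-z) y≢z wxy
      ; wyx = liftAvoiding keep (just≢nothing col-z) x≢z wyx
      ; wyz = mapWalk (λ (p , v≢c) → keep v≢c p) r
      ; wzy = exit ⟨ z-coloured ⟩ liftAvoiding keep (just≢nothing col-z) y≢z wzy
      ; wxz = mapWalk (λ (p , v≢c) → keep v≢c p) r′ }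
      where
      col″ : Colouring n
      col″ = recolour (_≟ c) nothing (recolour (_≟ z) (just zy) col)
      uncoloured : ∀ {v m} → v ≢ c → v ≢ z → col v ≡ m → col″ v ≡ m
      uncoloured v≢c v≢z p = trans (recolour-out (_≟ c) v≢c) (trans (recolour-out (_≟ z) v≢z) p)
      keep : ∀ {j v} → v ≢ c → Coloured col j v → Coloured col″ j v
      keep v≢c p = uncoloured v≢c (λ { refl → just≢nothing col-z p }) p
      z-coloured : Coloured col″ zy z
      z-coloured = trans (recolour-out (_≟ c) z≢c) (recolour-in (_≟ z) refl)

    -- If `y` were `t`, both walks into `y` might be diverted to `c`. The only arc known to leave
    -- `c` goes to `t`, so the two walks out of `y` could not start there.
    uncontract : y ≢ t → Subdivision G y
    uncontract y≢t with x ≟ t | z ≟ t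
    ... | yes x≡t | _ = lift-x x≡t
    ... | no _ | yes z≡t = lift-z z≡t
    ... | no x≢t | no z≢t = liftInternal x≢t y≢t z≢t

-- Staircases and forks starting at `t`

TwoInto : Graph n → Fin n → List (Fin n) → Set
TwoInto G u l = ∃₂ λ a b → a ∈ l × b ∈ l × a ≢ b × G u a × G u b

twoInto? : {G : Graph n} → (∀ u w → Dec (G u w)) → ∀ u l → Dec (TwoInto G u l)
twoInto? {G = G} G? u l =
  map′ to from (any? (λ a → G? u a ×-dec any? (λ b → ¬? (a ≟ b) ×-dec G? u b) l) l)
  where
  to : Any (λ a → G u a × Any (λ b → a ≢ b × G u b) l) l → TwoInto G u l
  to p with find p
  ... | a , a∈l , ua , q with find q
  ...   | b , b∈l , a≢b , ub = a , b , a∈l , b∈l , a≢b , ua , ub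
  from : TwoInto G u l → Any (λ a → G u a × Any (λ b → a ≢ b × G u b) l) l
  from (a , b , a∈l , b∈l , a≢b , ua , ub) = lose a∈l (ua , lose b∈l (a≢b , ub))

data Staircase (G : Graph n) (s t : Fin n) : List (Fin n) → Set where
  base : G s t → s ≢ t → Staircase G s t (s ∷ t ∷ [])
  step : ∀ {c l} → c ∉ l → TwoInto G c l → Staircase G s t l → Staircase G s t (c ∷ l)

module _ {G : Graph n} {s t : Fin n} where

  s∈ : ∀ {l} → Staircase G s t l → s ∈ l
  s∈ (base _ _) = here refl
  s∈ (step _ _ st) = there (s∈ st)

  t∈ : ∀ {l} → Staircase G s t l → t ∈ l
  t∈ (base _ _) = there (here refl)
  t∈ (step _ _ st) = there (t∈ st)

  -- Each entry put in front has an arc to a later one, and `s` has its arc to `t`. Moving down the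
  -- list never returns to `h`.
  descend : ∀ {l h} → Staircase G s t l → h ∈ l → h ≢ t →
            Walk G (λ v → v ∈ l × v ≢ h × v ≢ t) h t
  descend (base g _) (here refl) _ = arc g
  descend (base _ _) (there (here refl)) h≢t = contradiction refl h≢t
  descend (step _ _ st) (there h∈l) h≢t = mapWalk (λ (v∈l , r) → there v∈l , r) (descend st h∈l h≢t)
  descend (step {c} c∉l (a , _ , a∈l , _ , _ , g , _) st) (here refl) _ with a ≟ t
  ... | yes refl = arc g
  ... | no a≢t = g ⟨ there a∈l , ≢c a∈l , a≢t ⟩
                 mapWalk (λ (v∈l , _ , v≢t) → there v∈l , ≢c v∈l , v≢t) (descend st a∈l a≢t)
    where
    ≢c : ∀ {v} → v ∈ _ → v ≢ c
    ≢c v∈l refl = c∉l v∈l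

  -- The colours anticipate that `t` becomes `y` and the heads become `x` and `z`. Since `l` stays
  -- uncoloured, the heads can go on moving through it.
  record Fork (l : List (Fin n)) (h₁ h₂ : Fin n) : Set where
    field
      col : Colouring n
      free : ∀ {v} → v ∈ l → col v ≡ nothing
      walk₁ : Walk G (Coloured col yx) t h₁
      walk₂ : Walk G (Coloured col yz) t h₂

  tailFork : ∀ {c l h₁ h₂} → Fork (c ∷ l) h₁ h₂ → Fork l h₁ h₂
  tailFork f = record { Fork f ; free = Fork.free f ∘ there }

  -- Either head may be in front; a swap makes it the first, as `advance` expects.
  swapFork : ∀ {l h₁ h₂} → Fork l h₁ h₂ → Fork l h₂ h₁
  swapFork f = record
    { col = Maybe.map swap ∘ col
    ; free = λ v∈l → cong (Maybe.map swap) (free v∈l)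
    ; walk₁ = mapWalk (cong (Maybe.map swap)) walk₂
    ; walk₂ = mapWalk (cong (Maybe.map swap)) walk₁ }
    where
    open Fork f
    swap : Fin 5 → Fin 5
    swap yx = yz
    swap yz = yx
    swap i = i

  moveFork : ∀ {c l h₂ a} → c ∉ l → G c a → Fork (c ∷ l) c h₂ → Fork l a h₂
  moveFork {c} {l} c∉l g f = record
    { col = recolour (_≟ c) (just yx) col
    ; free = λ v∈l → trans (recolour-out (_≟ c) (λ { refl → c∉l v∈l })) (free (there v∈l))
    ; walk₁ = snoc (mapWalk keep walk₁) (recolour-in (_≟ c) refl) g
    ; walk₂ = mapWalk keep walk₂ }
    where
    open Fork f
    keep : ∀ {i v} → Coloured col i v → Coloured (recolour (_≟ c) (just yx) col) i v
    keep p = trans (recolour-out (_≟ c) (λ { refl → just≢nothing (free (here refl)) p })) p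

  -- With `c` as `x` and `h` as `z`, the fork gives the walks out of `y` and two arcs those out of
  -- `x`. The walk from `z` descends inside `l`, clear of the fork.
  closeFork : ∀ {c l h} → Staircase G s t l → c ∉ l → h ∈ l → h ≢ t → G c t → G c h →
              Fork (c ∷ l) c h → Subdivision G t
  closeFork {c} {l} {h} st c∉l h∈l h≢t ct ch f = record
    { x≢y = λ { refl → c∉l (t∈ st) } ; x≢z = λ { refl → c∉l h∈l } ; y≢z = ≢-sym h≢t
    ; col = col′
    ; col-x = trans (recolour-out P? (c∉l ∘ proj₁)) (free (here refl))
    ; col-y = trans (recolour-out P? (λ (_ , _ , t≢t) → t≢t refl)) (free (there (t∈ st)))
    ; col-z = trans (recolour-out P? (λ (_ , h≢h , _) → h≢h refl)) (free (there h∈l))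
    ; wxy = arc ct
    ; wyx = mapWalk keep walk₁
    ; wyz = mapWalk keep walk₂
    ; wzy = mapWalk (recolour-in P?) (descend st h∈l h≢t)
    ; wxz = arc ch }
    where
    open Fork f
    P? : Decidable (λ v → v ∈ l × v ≢ h × v ≢ t)
    P? v = _∈?_ _≟_ v l ×-dec ¬? (v ≟ h) ×-dec ¬? (v ≟ t)
    col′ : Colouring n
    col′ = recolour P? (just zy) col
    keep : ∀ {i v} → Coloured col i v → Coloured col′ i v
    keep p = trans (recolour-out P? (λ (v∈l , _) → just≢nothing (free (there v∈l)) p)) p

  advance : ∀ {c l} → Staircase G s t l → c ∉ l → TwoInto G c l →
            (∀ {h₁ h₂} → h₁ ∈ l → h₂ ∈ l → h₁ ≢ h₂ → h₁ ≢ t → h₂ ≢ t → Fork l h₁ h₂ → Subdivision G t) →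
            ∀ {h} → h ∈ l → h ≢ t → Fork (c ∷ l) c h → Subdivision G t
  advance st c∉l (a , b , a∈l , b∈l , a≢b , ca , cb) rec {h} h∈l h≢t f
    with a ≟ t | a ≟ h | b ≟ t | b ≟ h
  ... | no a≢t | no a≢h | _ | _ = rec a∈l h∈l a≢h a≢t h≢t (moveFork c∉l ca f)
  ... | _ | _ | no b≢t | no b≢h = rec b∈l h∈l b≢h b≢t h≢t (moveFork c∉l cb f)
  -- No move is possible any more, so `a` and `b` both lie among `t` and `h`; being distinct, they
  -- are these two.
  ... | yes refl | _ | _ | yes refl = closeFork st c∉l h∈l h≢t ca cb f
  ... | _ | yes refl | yes refl | _ = closeFork st c∉l h∈l h≢t cb ca f
  ... | yes refl | _ | yes refl | _ = contradiction refl a≢b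
  ... | _ | yes refl | _ | yes refl = contradiction refl a≢b

  -- The fork must close before only `s` and `t` are left, for these cannot hold two distinct heads
  -- other than `t`.
  runFork : ∀ {l} → Staircase G s t l → ∀ {h₁ h₂} → h₁ ∈ l → h₂ ∈ l → h₁ ≢ h₂ → h₁ ≢ t → h₂ ≢ t →
            Fork l h₁ h₂ → Subdivision G t
  runFork _ (here refl) (here refl) h₁≢h₂ _ _ _ = contradiction refl h₁≢h₂
  runFork (base _ _) (there (here refl)) _ _ h₁≢t _ _ = contradiction refl h₁≢t
  runFork (base _ _) _ (there (here refl)) _ _ h₂≢t _ = contradiction refl h₂≢t
  runFork (step c∉l two st) (here refl) (there h₂∈l) _ _ h₂≢t f =
    advance st c∉l two (runFork st) h₂∈l h₂≢t f
  runFork (step c∉l two st) (there h₁∈l) (here refl) _ h₁≢t _ f =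
    advance st c∉l two (runFork st) h₁∈l h₁≢t (swapFork f)
  runFork (step _ _ st) (there h₁∈l) (there h₂∈l) h₁≢h₂ h₁≢t h₂≢t f =
    runFork st h₁∈l h₂∈l h₁≢h₂ h₁≢t h₂≢t (tailFork f)

  returning : (∀ {v} → ¬ G v v) → ∀ {l} → Staircase G s t l → TwoInto G t l → Subdivision G t
  returning irr st (a , b , a∈l , b∈l , a≢b , ta , tb) =
    runFork st a∈l b∈l a≢b (λ { refl → irr ta }) (λ { refl → irr tb })
      (record { col = λ _ → nothing ; free = λ _ → refl ; walk₁ = arc ta ; walk₂ = arc tb })

-- Contracting a list of vertices to t

data Contract (G : Graph n) (t : Fin n) (l : List (Fin n)) (u w : Fin n) : Set where
  outside : u ≡ t ⊎ u ∉ l → w ∉ l → G u w → Contract G t l u w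
  inside : u ∉ l → w ≡ t → Any (G u) l → Contract G t l u w

module _ {G : Graph n} {t : Fin n} where

  contract? : (∀ u w → Dec (G u w)) → ∀ l u w → Dec (Contract G t l u w)
  contract? G? l u w = map′ to from
    (((u ≟ t ⊎-dec ¬? (u ∈l?)) ×-dec ¬? (w ∈l?) ×-dec G? u w) ⊎-dec
     (¬? (u ∈l?) ×-dec w ≟ t ×-dec any? (G? u) l))
    where
    _∈l? : ∀ v → Dec (v ∈ l)
    v ∈l? = _∈?_ _≟_ v l
    to : _ → Contract G t l u w
    to (inj₁ (p , q , g)) = outside p q g
    to (inj₂ (p , q , g)) = inside p q g
    from : Contract G t l u w → _
    from (outside p q g) = inj₁ (p , q , g)
    from (inside p q g) = inj₂ (p , q , g)

  -- Once `l` is contracted, the arc from `c` to `a` is an arc to `t`, so `c` can be contracted in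
  -- turn; the arcs into `c` are still intact at that stage.
  contractOne : ∀ {c a l} → c ∉ l → t ∈ l → a ∈ l → G c a →
                Contracts (Contract G t l) c t (Contract G t (c ∷ l))
  contractOne {c} {a} {l} c∉l t∈l a∈l ca = record
    { exit = inside c∉l refl (lose a∈l ca)
    ; c≢t = c≢t
    ; source = λ { (outside (inj₁ refl) _ _) refl → c≢t refl
                 ; (outside (inj₂ u∉) _ _) refl → u∉ (here refl)
                 ; (inside u∉ _ _) refl → u∉ (here refl) }
    ; target = λ { (outside _ w∉ _) refl → w∉ (here refl)
                 ; (inside _ refl _) refl → c≢t refl }
    ; arcs = λ { (outside (inj₁ u≡t) w∉ g) → inj₁ (outside (inj₁ u≡t) (w∉ ∘ there) g)
               ; (outside (inj₂ u∉) w∉ g) → inj₁ (outside (inj₂ (u∉ ∘ there)) (w∉ ∘ there) g)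
               ; (inside u∉ refl (here g)) → inj₂ (refl , outside (inj₂ (u∉ ∘ there)) c∉l g)
               ; (inside u∉ w≡t (there p)) → inj₁ (inside (u∉ ∘ there) w≡t p) } }
    where
    c≢t : c ≢ t
    c≢t refl = c∉l t∈l

  -- The vertex that joined last is released first: its out-neighbours in the list are then still
  -- contracted to `t`, which provides the exit.
  expand : ∀ {s l y} → Staircase G s t l → y ≢ t → Subdivision (Contract G t l) y → Subdivision G y
  expand (step c∉l (_ , _ , a∈l , _ , _ , ca , _) st) y≢t S =
    expand st y≢t (uncontract (contractOne c∉l (t∈ st) a∈l ca) S y≢t)
  -- After `s` is released only `t` itself is contracted, which adds no arcs.
  expand (base st s≢t) y≢t S = mapSubdivision trivial
    (uncontract (contractOne (λ { (here s≡t) → s≢t s≡t ; (there ()) }) (here refl) (here refl) st) S y≢t)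
    where
    trivial : ∀ {u w} → Contract G t (t ∷ []) u w → G u w
    trivial (outside _ _ g) = g
    trivial (inside _ refl (here g)) = g

-- Induction on the number of vertices

record AlmostTwoOut (G : Graph n) (V : List (Fin n)) (s : Fin n) : Set where
  field
    dec : ∀ u w → Dec (G u w)
    irr : ∀ {v} → ¬ G v v
    closed : ∀ {u w} → G u w → w ∈ V
    s∈V : s ∈ V
    exit : ∃ (G s)
    two : ∀ {u} → u ∈ V → u ≢ s → ∃₂ λ a b → a ≢ b × G u a × G u b

-- In a contraction `t` is the exceptional vertex, so `y ≢ s` there becomes the `y ≢ t` that
-- `expand` demands.
Good : Graph n → Fin n → Set
Good G s = ∃[ y ] y ≢ s × Subdivision G y

remove : Fin n → List (Fin n) → List (Fin n)
remove c = filter (λ v → ¬? (v ≟ c))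

length-remove : ∀ {c : Fin n} l → c ∈ l → length (remove c l) < length l
length-remove l c∈l = filter-notAll _ l (lose c∈l (λ c≢c → c≢c refl))

module _ {G : Graph n} {V : List (Fin n)} {s t : Fin n} (almost : AlmostTwoOut G V s) (t≢s : t ≢ s)
         (ih : ∀ {H : Graph n} {W u} → length W < length V → AlmostTwoOut H W u → Good H u) where
  open AlmostTwoOut almost

  -- Each round moves a vertex from `W` to `l`, so `k` bounds the rounds. When none can be moved,
  -- `t ∷ W` lists the contracted graph and is shorter than `V`.
  grow : ∀ k {l W} → length W < k → suc (length W) < length V → Staircase G s t l →
         (∀ {v} → v ∈ V → v ∈ l ⊎ v ∈ W) → (∀ {v} → v ∈ W → v ∈ V × v ∉ l) → t ∈ V → Good G s
  grow (suc k) {l} {W} W<k W<V st cover rest t∈V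
    with twoInto? dec t l | any? (λ u → twoInto? dec u l) W
  ... | yes tt | _ = t , t≢s , returning irr st tt
  ... | no _ | yes p with find p
  ...   | c , c∈W , cc =
    grow k (<-≤-trans (length-remove W c∈W) (s≤s⁻¹ W<k))
      (≤-trans (s≤s (length-remove W c∈W)) (<⇒≤ W<V))
      (step (proj₂ (rest c∈W)) cc st) cover′ rest′ t∈V
    where
    cover′ : ∀ {v} → v ∈ V → v ∈ c ∷ l ⊎ v ∈ remove c W
    cover′ {v} v∈V with v ≟ c | cover v∈V
    ... | yes v≡c | _ = inj₁ (here v≡c)
    ... | no _ | inj₁ v∈l = inj₁ (there v∈l)
    ... | no v≢c | inj₂ v∈W = inj₂ (∈-filter⁺ _ v∈W v≢c)
    rest′ : ∀ {v} → v ∈ remove c W → v ∈ V × v ∉ c ∷ l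
    rest′ v∈ with ∈-filter⁻ _ v∈
    ... | v∈W , v≢c = proj₁ (rest v∈W) , λ { (here v≡c) → v≢c v≡c ; (there v∈l) → proj₂ (rest v∈W) v∈l }
  grow (suc k) {l} {W} W<k W<V st cover rest t∈V | no ¬tt | no ¬any
    with ih {Contract G t l} {t ∷ W} {t} W<V contracted
    where
    _∈l? : ∀ v → Dec (v ∈ l)
    v ∈l? = _∈?_ _≟_ v l
    -- By `¬tt`, at least one of two out-neighbours of `t` lies outside `l`, and that arc survives.
    exit′ : ∃ (Contract G t l t)
    exit′ with two t∈V t≢s
    ... | a , b , a≢b , ta , tb with a ∈l? | b ∈l?
    ...   | no a∉l | _ = a , outside (inj₁ refl) a∉l ta
    ...   | yes _ | no b∉l = b , outside (inj₁ refl) b∉l tb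
    ...   | yes a∈l | yes b∈l = contradiction (a , b , a∈l , b∈l , a≢b , ta , tb) ¬tt
    -- By `¬any`, at most one of the two out-neighbours is replaced by `t`, so they stay distinct.
    two′ : ∀ {u} → u ∈ t ∷ W → u ≢ t → ∃₂ λ a b → a ≢ b × Contract G t l u a × Contract G t l u b
    two′ (here u≡t) u≢t = contradiction u≡t u≢t
    two′ (there u∈W) _ with rest u∈W
    ... | u∈V , u∉l with two u∈V (λ { refl → u∉l (s∈ st) })
    ...   | a , b , a≢b , ua , ub with a ∈l? | b ∈l?
    ...     | no a∉l | no b∉l = a , b , a≢b , outside (inj₂ u∉l) a∉l ua , outside (inj₂ u∉l) b∉l ub
    ...     | yes a∈l | no b∉l =
      t , b , (λ { refl → b∉l (t∈ st) }) , inside u∉l refl (lose a∈l ua) , outside (inj₂ u∉l) b∉l ub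
    ...     | no a∉l | yes b∈l =
      a , t , (λ { refl → a∉l (t∈ st) }) , outside (inj₂ u∉l) a∉l ua , inside u∉l refl (lose b∈l ub)
    ...     | yes a∈l | yes b∈l = contradiction (lose u∈W (a , b , a∈l , b∈l , a≢b , ua , ub)) ¬any
    closed′ : ∀ {u w} → Contract G t l u w → w ∈ t ∷ W
    closed′ (inside _ w≡t _) = here w≡t
    closed′ (outside _ w∉l g) with cover (closed g)
    ... | inj₁ w∈l = contradiction w∈l w∉l
    ... | inj₂ w∈W = there w∈W
    contracted : AlmostTwoOut (Contract G t l) (t ∷ W) t
    contracted = record
      { dec = contract? dec l
      ; irr = λ { (outside _ _ g) → irr g ; (inside t∉l refl _) → t∉l (t∈ st) }
      ; closed = closed′
      ; s∈V = here refl
      ; exit = exit′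
      ; two = two′ }
  ... | y , y≢t , S = y , y≢s , expand st y≢t S
    where
    -- In the contraction no arc leaves a vertex of `l` other than `t`, but a walk starts at `y`.
    y≢s : y ≢ s
    y≢s refl with firstArc (Subdivision.wyx S)
    ... | _ , outside (inj₁ y≡t) _ _ = y≢t y≡t
    ... | _ , outside (inj₂ y∉l) _ _ = y∉l (s∈ st)
    ... | _ , inside y∉l _ _ = y∉l (s∈ st)

-- Contractions stay on `Fin n` and only shorten the list `V`, whose length is the measure of the
-- induction.
almostTwoOut⇒good : ∀ k {G : Graph n} {V s} → length V < k → AlmostTwoOut G V s → Good G s
almostTwoOut⇒good (suc k) {G} {V} {s} V<k almost =
  grow almost t≢s (λ W<V → almostTwoOut⇒good k (<-≤-trans W<V (s≤s⁻¹ V<k))) (suc (length W)) ≤-refl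
    -- Removing both `s` and `t` makes room for `t` in the contracted list.
    (≤-trans (s≤s (length-remove (remove s V) t∈V′)) (length-remove V s∈V))
    (base (proj₂ exit) (≢-sym t≢s)) cover rest (closed (proj₂ exit))
  where
  open AlmostTwoOut almost
  t : Fin _
  t = proj₁ exit
  t≢s : t ≢ s
  t≢s t≡s = irr (subst (G s) t≡s (proj₂ exit))
  t∈V′ : t ∈ remove s V
  t∈V′ = ∈-filter⁺ _ (closed (proj₂ exit)) t≢s
  W : List (Fin _)
  W = remove t (remove s V)
  cover : ∀ {v} → v ∈ V → v ∈ s ∷ t ∷ [] ⊎ v ∈ W
  cover {v} v∈V with v ≟ s | v ≟ t
  ... | yes v≡s | _ = inj₁ (here v≡s)
  ... | no _ | yes v≡t = inj₁ (there (here v≡t))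
  ... | no v≢s | no v≢t = inj₂ (∈-filter⁺ _ (∈-filter⁺ _ v∈V v≢s) v≢t)
  rest : ∀ {v} → v ∈ W → v ∈ V × v ∉ s ∷ t ∷ []
  rest v∈W with ∈-filter⁻ _ v∈W
  ... | v∈V′ , v≢t with ∈-filter⁻ _ v∈V′
  ...   | v∈V , v≢s = v∈V , λ { (here v≡s) → v≢s v≡s ; (there (here v≡t)) → v≢t v≡t }

-- From out-degrees to out-neighbours, and the theorem

module _ (f : Fin n → Bool) where

  private
    count : List (Fin n) → ℕ
    count = sum ∘ map (λ u → if f u then 1 else 0)

  one-counted : ∀ l → 1 ≤ count l → ∃[ a ] a ∈ l × T (f a)
  one-counted (u ∷ l) le with f u in eq
  ... | true = u , here refl , subst T (sym eq) _
  ... | false with one-counted l le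
  ...   | a , a∈l , fa = a , there a∈l , fa

  two-counted : ∀ {l} → Unique l → 2 ≤ count l → ∃₂ λ a b → a ≢ b × T (f a) × T (f b)
  two-counted {u ∷ l} (u∉l ∷ un) le with f u in eq
  ... | false = two-counted un le
  ... | true with one-counted l (s≤s⁻¹ le)
  ...   | b , b∈l , fb = u , b , All.lookup u∉l b∈l , subst T (sym eq) _ , fb

theorem1p2 : (n : ℕ) (A : Digraph n) → 1 ≤ n → Loopless A → MinOutDeg≥ A 2 → SubdivK3e A
theorem1p2 (suc n) A _ loopless deg = toSubdivK3e (proj₂ (proj₂ (almostTwoOut⇒good _ ≤-refl almost)))
  where
  two : ∀ u → ∃₂ λ a b → a ≢ b × Arc A u a × Arc A u b
  two u = two-counted (A u) (Unique.allFin⁺ _) (deg u)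
  -- Every vertex of `A` has two out-neighbours, so `zero` is an arbitrary choice of exceptional
  -- vertex.
  almost : AlmostTwoOut (Arc A) (allFin _) zero
  almost = record
    { dec = λ u w → T? (A u w)
    ; irr = λ {v} → loopless v
    ; closed = λ _ → ∈-allFin _
    ; s∈V = ∈-allFin _
    ; exit = let _ , _ , _ , g , _ = two zero in _ , g
    ; two = λ _ _ → two _ }
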